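{- Let $H=\{h_n\}_{n\ge1}$ be a sequence of highly composite numbers with the property that $n!\mid h_n$ for each positive integer $n$. Then the factorial set $H_{h_1}$ of $H$ is self-factorial, and for every integer $k\ge1$ the series $$\sum_{n=1}^{\infty}\frac{1}{\left\{h_1^{\lfloor n/1\rfloor}\,h_2^{\lfloor n/2\rfloor}\,h_3^{\lfloor n/3\rfloor}\cdots h_n^{\lfloor n/n\rfloor}\right\}^{k}}$$ is irrational.
   Context: A positive integer $N$ is highly composite if $d(m)<d(N)$ for every positive integer $m<N$, where $d$ is the number-of-divisors function. Given a sequence $(b_1,b_2,\dots)$ of positive integers, its factorial set (with first element $b_1$) is the sequence $B_0=1$, $B_n=\prod_{i=1}^{n}b_i^{\lfloor n/i\rfloor}$ for $n\ge1$; $H_{h_1}$ is the factorial set of $H$ with first element $h_1$. A factorial set $\{B_n\}$ is self-factorial if $n!\mid B_n$ for every $n$. -}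

module Defs where

open import Data.Integer.Base using (1ℤ)
open import Data.List.Base using (List; length; filter; applyUpTo)
open import Data.List.Relation.Unary.All.Properties using (applyUpTo⁺₂)
open import Data.Nat.Base using (ℕ; zero; suc; NonZero; _≤_; _<_; _^_; _/_; _!)
open import Data.Nat.Divisibility using (_∣_; _∣?_)
open import Data.Nat.ListAction using (product)
open import Data.Nat.ListAction.Properties using (product≢0)
open import Data.Nat.Properties using (m^n≢0)
open import Data.Product.Base using (∃-syntax; _,_)
open import Data.Rational.Base as ℚ using (ℚ; 0ℚ)
import Data.Rational.Properties as ℚ
open import Relation.Binary.PropositionalEquality using (sym; cong; subst)
open import Relation.Nullary using (¬_)

-- Sequences a₁, a₂, a₃, …; there is no term of index 0.

Sequence : Set → Set
Sequence A = (n : ℕ) .{{_ : NonZero n}} → A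

divisors : ℕ → List ℕ
divisors n = filter (_∣? n) (applyUpTo suc n)

d : ℕ → ℕ
d n = length (divisors n)

record HighlyComposite (N : ℕ) : Set where
  field
    positive : NonZero N
    maximal  : ∀ m .{{_ : NonZero m}} → m < N → d m < d N

-- The index i of applyUpTo starts at 0, so the factors are b₁^⌊n/1⌋, …, bₙ^⌊n/n⌋;
-- for n = 0 the product is empty.

factorialSet : Sequence ℕ → ℕ → ℕ
factorialSet b n = product (applyUpTo (λ i → b (suc i) ^ (n / suc i)) n)

SelfFactorial : (ℕ → ℕ) → Set
SelfFactorial B = ∀ n → n ! ∣ B n

factorialSet≢0 : ∀ (b : Sequence ℕ) → (∀ n .{{_ : NonZero n}} → NonZero (b n)) →
                 ∀ n → NonZero (factorialSet b n)
factorialSet≢0 b b≢0 n =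
  product≢0 (applyUpTo⁺₂ _ n λ i → m^n≢0 (b (suc i)) (n / suc i) {{b≢0 (suc i)}})

reciprocalPowers : ∀ (b : Sequence ℕ) → (∀ n .{{_ : NonZero n}} → NonZero (b n)) →
                   ℕ → Sequence ℚ
reciprocalPowers b b≢0 k n =
  ℚ._/_ 1ℤ (factorialSet b n ^ k) {{m^n≢0 (factorialSet b n) k {{factorialSet≢0 b b≢0 n}}}}

-- Real numbers are Cauchy sequences of rationals, compared by _≃_.

Eventually : (ℕ → Set) → Set
Eventually P = ∃[ N ] (∀ n → N ≤ n → P n)

IsCauchy : (ℕ → ℚ) → Set
IsCauchy s = ∀ ε → 0ℚ ℚ.< ε → ∃[ N ] (∀ m n → N ≤ m → N ≤ n → ℚ.∣ s m ℚ.- s n ∣ ℚ.< ε)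

record ℝ : Set where
  constructor mkℝ
  field
    approx : ℕ → ℚ
    cauchy : IsCauchy approx

open ℝ public

infix 4 _≃_ _⟶_

_≃_ : ℝ → ℝ → Set
x ≃ y = ∀ ε → 0ℚ ℚ.< ε → Eventually λ n → ℚ.∣ approx x n ℚ.- approx y n ∣ ℚ.< ε

fromℚ : ℚ → ℝ
fromℚ q = mkℝ (λ _ → q) λ ε 0<ε →
  0 , λ _ _ _ _ → subst (ℚ._< ε) (sym (cong ℚ.∣_∣ (ℚ.+-inverseʳ q))) 0<ε

Irrational : ℝ → Set
Irrational x = ¬ (∃[ q ] x ≃ fromℚ q)

-- The inner Eventually implies ∣ s n - x ∣ ≤ ε and is implied by ∣ s n - x ∣ < ε as real
-- numbers; under the quantification over all ε the two bounds give the same notion.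

_⟶_ : (ℕ → ℚ) → ℝ → Set
s ⟶ x = ∀ ε → 0ℚ ℚ.< ε → Eventually λ n → Eventually λ m → ℚ.∣ s n ℚ.- approx x m ∣ ℚ.< ε

partialSum : Sequence ℚ → ℕ → ℚ
partialSum a zero    = 0ℚ
partialSum a (suc n) = partialSum a n ℚ.+ a (suc n)

HasSum : Sequence ℚ → ℝ → Set
HasSum a x = partialSum a ⟶ x

{-# OPTIONS --safe #-}

-- Write B n for the factorial set. Since ⌊n/i⌋ ≤ ⌊(n+1)/i⌋, the product B n · h (n+1) divides
-- B (n+1), so D n = (B n)^k satisfies D (n+1) = D n · e n with e n ≥ (n+1)! > n. The partial
-- sums are therefore P n / D n with P (n+1) = P n · e n + 1, and as 2 · D n ≤ D (n+1) for n ≥ 1,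
-- the series converges to a value between P n / D n and (P n + 1) / D n. If that value were a/b,
-- the integer r n = a · D n - b · P n would satisfy 0 ≤ r n ≤ b for n ≥ 1 and
-- e n · r n = r (n+1) + b ∈ [b, 2 b]. Thus r n > 0 and n < e n ≤ 2 b, which fails at n = 2 b.

module Submission where

open import Defs
open import Data.Integer.Base as ℤ using (+_; -[1+_])
import Data.Integer.Properties as ℤ
open import Data.List.Base using ([]; _∷_; applyUpTo; _∷ʳ_)
open import Data.List.Properties using (applyUpTo-∷ʳ)
open import Data.Nat.Base
  using (ℕ; zero; suc; NonZero; _≤_; _<_; _≤′_; ≤′-refl; ≤′-step; z≤n; s≤s; _+_;
         _*_; _^_; _⊔_; _!; >-nonZero; >-nonZero⁻¹)
open import Data.Nat.DivMod using (/-monoˡ-≤; n/n≡1)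
open import Data.Nat.Divisibility
  using (_∣_; ∣-refl; ∣-trans; ∣-reflexive; *-pres-∣; n∣m*n; m∣m*n; quotient;
         m∣n⇒n≡m*quotient; ∣⇒≤)
open import Data.Nat.ListAction using (product)
open import Data.Nat.ListAction.Properties using (product-++)
open import Data.Nat.Properties
open import Data.Nat.Tactic.RingSolver using (solve-∀)
open import Data.Product.Base using (_×_; ∃-syntax; _,_)
open import Data.Rational.Base as ℚ using (ℚ; mkℚ; 0ℚ; toℚᵘ)
import Data.Rational.Properties as ℚ
open import Data.Rational.Unnormalised.Base as ℚᵘ using (mkℚᵘ; *≡*; *≤*)
import Data.Rational.Unnormalised.Properties as ℚᵘ
open import Algebra.Properties.AbelianGroup ℚ.+-0-abelianGroup using (xyx⁻¹≈y; ⁻¹-anti-homo-//)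
open import Data.Sum.Base using (_⊎_; inj₁; inj₂)
open import Function.Base using (_∘_)
open import Relation.Binary.PropositionalEquality
open import Relation.Nullary using (¬_)

-- Fractions with natural numerator and denominator.

infixl 7 _//_

_//_ : (m n : ℕ) .{{_ : NonZero n}} → ℚ
m // n = + m ℚ./ n

-- The division of `ℚ` reduces to lowest terms, so numerator and denominator of `m // suc n` cannot
-- be read off. The unnormalised rationals keep both, and the cross-multiplication rules below are
-- proved there.
toℚᵘ-// : ∀ m n → toℚᵘ (m // suc n) ℚᵘ.≃ mkℚᵘ (+ m) n
toℚᵘ-// m n = ℚ.toℚᵘ-fromℚᵘ (mkℚᵘ (+ m) n)

+-*-+-mono-≤ : ∀ a b c d → a * b ≤ c * d → + a ℤ.* + b ℤ.≤ + c ℤ.* + d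
+-*-+-mono-≤ a b c d le = subst₂ ℤ._≤_ (ℤ.pos-* a b) (ℤ.pos-* c d) (ℤ.+≤+ le)

+-*-+-cancel-≤ : ∀ a b c d → + a ℤ.* + b ℤ.≤ + c ℤ.* + d → a * b ≤ c * d
+-*-+-cancel-≤ a b c d le = ℤ.drop‿+≤+ (subst₂ ℤ._≤_ (sym (ℤ.pos-* a b)) (sym (ℤ.pos-* c d)) le)

//-≤ : ∀ a b c d .{{_ : NonZero b}} .{{_ : NonZero d}} → a * d ≤ c * b → a // b ℚ.≤ c // d
//-≤ a (suc b) c (suc d) ad≤cb = ℚ.toℚᵘ-cancel-≤ (begin
  toℚᵘ (a // suc b)  ≃⟨ toℚᵘ-// a b ⟩
  mkℚᵘ (+ a) b       ≤⟨ *≤* (+-*-+-mono-≤ a (suc d) c (suc b) ad≤cb) ⟩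
  mkℚᵘ (+ c) d       ≃⟨ toℚᵘ-// c d ⟨
  toℚᵘ (c // suc d)  ∎)
  where open ℚᵘ.≤-Reasoning

//-≤⁻¹ : ∀ a b c d .{{_ : NonZero b}} .{{_ : NonZero d}} → a // b ℚ.≤ c // d → a * d ≤ c * b
//-≤⁻¹ a (suc b) c (suc d) le = +-*-+-cancel-≤ a (suc d) c (suc b) (ℚᵘ.drop-*≤* (begin
  mkℚᵘ (+ a) b       ≃⟨ toℚᵘ-// a b ⟨
  toℚᵘ (a // suc b)  ≤⟨ ℚ.toℚᵘ-mono-≤ le ⟩
  toℚᵘ (c // suc d)  ≃⟨ toℚᵘ-// c d ⟩
  mkℚᵘ (+ c) d       ∎))
  where open ℚᵘ.≤-Reasoning

//-≡ : ∀ a b c d .{{_ : NonZero b}} .{{_ : NonZero d}} → a * d ≡ c * b → a // b ≡ c // d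
//-≡ a b c d ad≡cb =
  ℚ.≤-antisym (//-≤ a b c d (≤-reflexive ad≡cb)) (//-≤ c d a b (≤-reflexive (sym ad≡cb)))

//-< : ∀ a b c d .{{_ : NonZero b}} .{{_ : NonZero d}} → a * d < c * b → a // b ℚ.< c // d
//-< a b c d ad<cb = ℚ.≰⇒> λ c//d≤a//b → <⇒≱ ad<cb (//-≤⁻¹ c d a b c//d≤a//b)

//-+ : ∀ a c d .{{_ : NonZero d}} → a // d ℚ.+ c // d ≡ (a + c) // d
//-+ a c (suc d) = ℚ.toℚᵘ-injective (begin
  toℚᵘ (a // suc d ℚ.+ c // suc d)           ≈⟨ ℚ.toℚᵘ-homo-+ (a // suc d) (c // suc d) ⟩
  toℚᵘ (a // suc d) ℚᵘ.+ toℚᵘ (c // suc d)   ≈⟨ ℚᵘ.+-cong (toℚᵘ-// a d) (toℚᵘ-// c d) ⟩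
  mkℚᵘ (+ a) d ℚᵘ.+ mkℚᵘ (+ c) d             ≈⟨ *≡* same-denominator ⟩
  mkℚᵘ (+ (a + c)) d                         ≈⟨ toℚᵘ-// (a + c) d ⟨
  toℚᵘ ((a + c) // suc d)                    ∎)
  where
  open ℚᵘ.≃-Reasoning
  D = + suc d
  same-denominator : (+ a ℤ.* D ℤ.+ + c ℤ.* D) ℤ.* D ≡ + (a + c) ℤ.* (D ℤ.* D)
  same-denominator = trans (cong (ℤ._* D) (sym (ℤ.*-distribʳ-+ D (+ a) (+ c))))
    (ℤ.*-assoc (+ (a + c)) D D)

p≤p+m//n : ∀ p m n .{{_ : NonZero n}} → p ℚ.≤ p ℚ.+ m // n
p≤p+m//n p m n = ℚ.≤-trans (ℚ.≤-reflexive (sym (ℚ.+-identityʳ p)))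
  (ℚ.+-monoʳ-≤ p (//-≤ 0 1 m n z≤n))

-- Allows the irrationality argument to run entirely in `ℕ`.
nonNeg⇒// : ∀ {q} → 0ℚ ℚ.≤ q → ∃[ a ] ∃[ b-1 ] q ≡ a // suc b-1
nonNeg⇒// {q@(mkℚ (+ a) b-1 _)} _   = a , b-1 , sym (ℚ.↥p/↧p≡p q)
nonNeg⇒// {mkℚ -[1+ _ ] _ _}    0≤q with () ← ℚ.nonNegative 0≤q

1//n<ε : ∀ ε → 0ℚ ℚ.< ε → ∃[ N ] (∀ n .{{_ : NonZero n}} → N < n → 1 // n ℚ.< ε)
1//n<ε (mkℚ (+ zero) _ _)      0<ε with () ← ℚ.positive 0<ε
1//n<ε (mkℚ -[1+ _ ] _ _)      0<ε with () ← ℚ.positive 0<ε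
-- A positive numerator is at least 1, so `ε` is at least the reciprocal of its own denominator,
-- which therefore serves as threshold.
1//n<ε ε@(mkℚ (+ suc a) d-1 _) 0<ε = suc d-1 , λ n d<n →
  subst (1 // n ℚ.<_) (ℚ.↥p/↧p≡p ε) (//-< 1 n (suc a) (suc d-1)
    (≤-trans (≤-reflexive (cong suc (*-identityˡ _))) (≤-trans d<n (m≤m+n n (a * n)))))

-- Absolute values, and rational bounds on a real number.

p≤∣p∣ : ∀ p → p ℚ.≤ ℚ.∣ p ∣
p≤∣p∣ p with ℚ.≤-total 0ℚ p
... | inj₁ 0≤p = ℚ.≤-reflexive (sym (ℚ.0≤p⇒∣p∣≡p 0≤p))
... | inj₂ p≤0 = ℚ.≤-trans p≤0 (ℚ.0≤∣p∣ p)

∣p-q∣≡∣q-p∣ : ∀ p q → ℚ.∣ p ℚ.- q ∣ ≡ ℚ.∣ q ℚ.- p ∣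
∣p-q∣≡∣q-p∣ p q = trans (sym (ℚ.∣-p∣≡∣p∣ (p ℚ.- q))) (cong ℚ.∣_∣ (⁻¹-anti-homo-// p q))

p<q⇒0<q-p : ∀ {p q} → p ℚ.< q → 0ℚ ℚ.< q ℚ.- p
p<q⇒0<q-p {p} {q} p<q = subst (ℚ._< q ℚ.- p) (ℚ.+-inverseʳ p) (ℚ.+-monoˡ-< (ℚ.- p) p<q)

∣x-y∣≤width : ∀ {l δ x y} → l ℚ.≤ x → x ℚ.≤ l ℚ.+ δ → l ℚ.≤ y → y ℚ.≤ l ℚ.+ δ →
              ℚ.∣ x ℚ.- y ∣ ℚ.≤ δ
∣x-y∣≤width {l} {δ} {x} {y} l≤x x≤l+δ l≤y y≤l+δ = bound (ℚ.∣p∣≡p∨∣p∣≡-p (x ℚ.- y))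
  where
  difference : ∀ {u v} → u ℚ.≤ l ℚ.+ δ → l ℚ.≤ v → u ℚ.- v ℚ.≤ δ
  difference u≤l+δ l≤v =
    ℚ.≤-trans (ℚ.+-mono-≤ u≤l+δ (ℚ.neg-antimono-≤ l≤v)) (ℚ.≤-reflexive (xyx⁻¹≈y l δ))
  bound : ℚ.∣ x ℚ.- y ∣ ≡ x ℚ.- y ⊎ ℚ.∣ x ℚ.- y ∣ ≡ ℚ.- (x ℚ.- y) → ℚ.∣ x ℚ.- y ∣ ℚ.≤ δ
  bound (inj₁ eq) = ℚ.≤-trans (ℚ.≤-reflexive eq) (difference x≤l+δ l≤y)
  bound (inj₂ eq) =
    ℚ.≤-trans (ℚ.≤-reflexive (trans eq (⁻¹-anti-homo-// x y))) (difference y≤l+δ l≤x)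

-- If `q < l`, then `l - q` is an admissible tolerance, yet all late approximations stay at least
-- that far from `q`.
≃⇒≥ : ∀ (x : ℝ) q l → x ≃ fromℚ q → Eventually (λ n → l ℚ.≤ approx x n) → l ℚ.≤ q
≃⇒≥ x q l x≃q (M , l≤x) = ℚ.≮⇒≥ λ q<l →
  let N , close = x≃q (l ℚ.- q) (p<q⇒0<q-p q<l)
      n = M ⊔ N
  in ℚ.<-irrefl refl (ℚ.<-≤-trans (close n (m≤n⊔m M N))
       (ℚ.≤-trans (ℚ.+-monoˡ-≤ (ℚ.- q) (l≤x n (m≤m⊔n M N))) (p≤∣p∣ (approx x n ℚ.- q))))

≃⇒≤ : ∀ (x : ℝ) q u → x ≃ fromℚ q → Eventually (λ n → approx x n ℚ.≤ u) → q ℚ.≤ u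
≃⇒≤ x q u x≃q (M , x≤u) = ℚ.≮⇒≥ λ u<q →
  let N , close = x≃q (q ℚ.- u) (p<q⇒0<q-p u<q)
      n = M ⊔ N
  in ℚ.<-irrefl refl (ℚ.<-≤-trans (close n (m≤n⊔m M N))
       (ℚ.≤-trans (ℚ.+-monoʳ-≤ q (ℚ.neg-antimono-≤ (x≤u n (m≤m⊔n M N))))
         (ℚ.≤-trans (p≤∣p∣ (q ℚ.- approx x n)) (ℚ.≤-reflexive (∣p-q∣≡∣q-p∣ q (approx x n))))))

HasSum-partialSum : ∀ a (cauchy : IsCauchy (partialSum a)) → HasSum a (mkℝ (partialSum a) cauchy)
HasSum-partialSum a cauchy ε 0<ε with N , close ← cauchy ε 0<ε =
  N , λ n N≤n → N , λ m N≤m → close n m N≤n N≤m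

-- Irrationality of the sum of reciprocals along a divisibility chain with growing quotients.

module ReciprocalSeries
  (D : ℕ → ℕ) (D≢0 : ∀ n → NonZero (D n))
  (e : ℕ → ℕ) (D-suc : ∀ n → D (suc n) ≡ D n * e n) (n<e : ∀ n → n < e n) where

  private instance
    D-nonZero : ∀ {n} → NonZero (D n)
    D-nonZero {n} = D≢0 n

  terms : Sequence ℚ
  terms n = 1 // D n

  s : ℕ → ℚ
  s = partialSum terms

  P : ℕ → ℕ
  P zero    = 0
  P (suc n) = P n * e n + 1

  s≡P//D : ∀ n → s n ≡ P n // D n
  s≡P//D zero    = //-≡ 0 1 0 (D 0) refl
  s≡P//D (suc n) = begin
    s n ℚ.+ 1 // D (suc n)                       ≡⟨ cong (ℚ._+ 1 // D (suc n)) (s≡P//D n) ⟩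
    P n // D n ℚ.+ 1 // D (suc n)                ≡⟨ cong (ℚ._+ 1 // D (suc n)) scale ⟩
    (P n * e n) // D (suc n) ℚ.+ 1 // D (suc n)  ≡⟨ //-+ (P n * e n) 1 (D (suc n)) ⟩
    (P n * e n + 1) // D (suc n)                 ∎
    where
    open ≡-Reasoning
    rearrange : ∀ p d c → p * (d * c) ≡ p * c * d
    rearrange = solve-∀
    scale : P n // D n ≡ (P n * e n) // D (suc n)
    scale = //-≡ (P n) (D n) (P n * e n) (D (suc n))
      (trans (cong (P n *_) (D-suc n)) (rearrange (P n) (D n) (e n)))

  s-suc-≥ : ∀ n → s n ℚ.≤ s (suc n)
  s-suc-≥ n = p≤p+m//n (s n) 1 (D (suc n))

  -- The upper ends of the enclosing intervals decrease because `2 * D n ≤ D (suc n)`. This comes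
  -- from `n < e n` and needs `n ≥ 1`: at 0 only `e 0 ≥ 1` is known.
  s+term-suc-≤ : ∀ n .{{_ : NonZero n}} → s (suc n) ℚ.+ 1 // D (suc n) ℚ.≤ s n ℚ.+ 1 // D n
  s+term-suc-≤ n@(suc n-1) = begin
    (s n ℚ.+ 1 // D (suc n)) ℚ.+ 1 // D (suc n)  ≡⟨ ℚ.+-assoc (s n) _ _ ⟩
    s n ℚ.+ (1 // D (suc n) ℚ.+ 1 // D (suc n))  ≡⟨ cong (s n ℚ.+_) (//-+ 1 1 (D (suc n))) ⟩
    s n ℚ.+ 2 // D (suc n)                       ≤⟨ ℚ.+-monoʳ-≤ (s n) 2//D-suc≤1//D ⟩
    s n ℚ.+ 1 // D n                             ∎
    where
    open ℚ.≤-Reasoning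
    2//D-suc≤1//D : 2 // D (suc n) ℚ.≤ 1 // D n
    2//D-suc≤1//D = //-≤ 2 (D (suc n)) 1 (D n) (≤-trans (*-monoˡ-≤ (D n) (≤-trans (s≤s (s≤s z≤n)) (n<e n)))
      (≤-reflexive (trans (*-comm (e n) (D n)) (trans (sym (D-suc n)) (sym (*-identityˡ _))))))

  s-mono-≤ : ∀ {m n} → m ≤ n → s m ℚ.≤ s n
  s-mono-≤ m≤n = go (≤⇒≤′ m≤n)
    where
    go : ∀ {m n} → m ≤′ n → s m ℚ.≤ s n
    go ≤′-refl           = ℚ.≤-refl
    go (≤′-step {n} m≤n) = ℚ.≤-trans (go m≤n) (s-suc-≥ n)

  s+term-antimono-≤ : ∀ {m n} .{{_ : NonZero m}} → m ≤ n → s n ℚ.+ 1 // D n ℚ.≤ s m ℚ.+ 1 // D m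
  s+term-antimono-≤ {m} m≤n = go (≤⇒≤′ m≤n)
    where
    go : ∀ {n} → m ≤′ n → s n ℚ.+ 1 // D n ℚ.≤ s m ℚ.+ 1 // D m
    go ≤′-refl           = ℚ.≤-refl
    go (≤′-step {n} m≤n) = ℚ.≤-trans
      (s+term-suc-≤ n {{>-nonZero (≤-trans (>-nonZero⁻¹ m) (≤′⇒≤ m≤n))}}) (go m≤n)

  s-≤ : ∀ {m n} .{{_ : NonZero m}} → m ≤ n → s n ℚ.≤ s m ℚ.+ 1 // D m
  s-≤ {m} {n} m≤n = ℚ.≤-trans (p≤p+m//n (s n) 1 (D n)) (s+term-antimono-≤ m≤n)

  -- Makes the width `1 // D n` of the enclosing intervals tend to 0.
  n≤D : ∀ n → n ≤ D n
  n≤D zero    = z≤n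
  n≤D (suc n) = ≤-trans (n<e n) (≤-trans (m≤n*m (e n) (D n)) (≤-reflexive (sym (D-suc n))))

  s-cauchy : IsCauchy s
  -- From index `suc M` on, all partial sums lie in one interval of width `1 // D (suc M)`. The
  -- successor makes the index nonzero and the denominator exceed `M`.
  s-cauchy ε 0<ε with M , small ← 1//n<ε ε 0<ε = suc M , λ m n M<m M<n → ℚ.≤-<-trans
    (∣x-y∣≤width (s-mono-≤ M<m) (s-≤ M<m) (s-mono-≤ M<n) (s-≤ M<n))
    (small (D (suc M)) (n≤D (suc M)))

  sum : ℝ
  sum = mkℝ s s-cauchy

  lower : ∀ q → sum ≃ fromℚ q → ∀ n → P n // D n ℚ.≤ q
  lower q sum≃q n = ≃⇒≥ sum q _ sum≃q
    (n , λ m n≤m → subst (ℚ._≤ s m) (s≡P//D n) (s-mono-≤ n≤m))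

  upper : ∀ q → sum ≃ fromℚ q → ∀ n .{{_ : NonZero n}} → q ℚ.≤ (P n + 1) // D n
  upper q sum≃q n = ≃⇒≤ sum q _ sum≃q
    (n , λ m n≤m → ℚ.≤-trans (s-≤ n≤m)
      (ℚ.≤-reflexive (trans (cong (ℚ._+ 1 // D n) (s≡P//D n)) (//-+ (P n) 1 (D n)))))

  -- The difference r n = a · D n - b · P n is never formed: its bounds appear as inequalities
  -- between `a * D n` and `P n * b`, so no truncated subtraction occurs.
  ≄// : ∀ a b .{{_ : NonZero b}} → ¬ sum ≃ fromℚ (a // b)
  ≄// a b sum≃a//b = <⇒≱ (n<e n) (+-cancelˡ-≤ (P n * b * e n) (e n) n (begin
      P n * b * e n + e n      ≡⟨ +-comm _ (e n) ⟩
      suc (P n * b) * e n      ≤⟨ *-monoˡ-≤ (e n) Pb<aD ⟩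
      a * D n * e n            ≤⟨ aDe≤[Pe+2]b ⟩
      (P n * e n + 1 + 1) * b  ≡⟨ rearrange (P n) (e n) b ⟩
      P n * b * e n + n        ∎))
    where
    open ≤-Reasoning
    -- Chosen so that the final bound `e n ≤ 2 * b` contradicts `n < e n`.
    n = 2 * b
    aD-suc≡aDe : a * D (suc n) ≡ a * D n * e n
    aD-suc≡aDe = trans (cong (a *_) (D-suc n)) (sym (*-assoc a (D n) (e n)))
    -- The upper bound at `suc n`, that is, e n · r n ≤ 2 b.
    aDe≤[Pe+2]b : a * D n * e n ≤ (P n * e n + 1 + 1) * b
    aDe≤[Pe+2]b = subst (_≤ (P n * e n + 1 + 1) * b) aD-suc≡aDe
      (//-≤⁻¹ a b (P (suc n) + 1) (D (suc n)) (upper (a // b) sum≃a//b (suc n)))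
    -- The lower bound at `suc n`, that is, e n · r n ≥ b.
    [Pe+1]b≤aDe : (P n * e n + 1) * b ≤ a * D n * e n
    [Pe+1]b≤aDe = subst ((P n * e n + 1) * b ≤_) aD-suc≡aDe
      (//-≤⁻¹ (P (suc n)) (D (suc n)) a b (lower (a // b) sum≃a//b (suc n)))
    rearrange : ∀ p c b → (p * c + 1 + 1) * b ≡ p * b * c + 2 * b
    rearrange = solve-∀
    rearrange′ : ∀ p c b → (p * c + 1) * b ≡ p * b * c + b
    rearrange′ = solve-∀
    -- Positivity of r n: as b > 0, the lower bound is strict after dropping `b`, and `e n` cancels.
    Pb<aD : P n * b < a * D n
    Pb<aD = *-cancelʳ-< (e n) (P n * b) (a * D n) (begin-strict
      P n * b * e n        <⟨ m<m+n (P n * b * e n) (>-nonZero⁻¹ b) ⟩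
      P n * b * e n + b    ≡⟨ rearrange′ (P n) (e n) b ⟨
      (P n * e n + 1) * b  ≤⟨ [Pe+1]b≤aDe ⟩
      a * D n * e n        ∎)

  sum-irrational : Irrational sum
  sum-irrational (q , sum≃q) =
    -- The limit is nonnegative because `s 0` is `0ℚ` and the partial sums increase.
    let a , b-1 , q≡a//b = nonNeg⇒// (≃⇒≥ sum q 0ℚ sum≃q (0 , λ n _ → s-mono-≤ {n = n} z≤n))
    in ≄// a (suc b-1) (subst (λ r → sum ≃ fromℚ r) q≡a//b sum≃q)

-- Divisibility between consecutive terms of a factorial set.

^-distribʳ-* : ∀ k m n → (m * n) ^ k ≡ m ^ k * n ^ k
^-distribʳ-* zero    m n = refl
^-distribʳ-* (suc k) m n =
  trans (cong (m * n *_) (^-distribʳ-* k m n)) (interchange m n (m ^ k) (n ^ k))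
  where open import Algebra.Properties.CommutativeSemigroup *-commutativeSemigroup using (interchange)

^-monoʳ-∣ : ∀ b {m n} → m ≤ n → b ^ m ∣ b ^ n
^-monoʳ-∣ b {m} {n} m≤n with k , refl ← m≤n⇒∃[o]m+o≡n m≤n =
  subst (b ^ m ∣_) (sym (^-distribˡ-+-* b m k)) (m∣m*n (b ^ k))

product-applyUpTo-∣ : ∀ {f g} → (∀ i → f i ∣ g i) → ∀ n →
                      product (applyUpTo f n) ∣ product (applyUpTo g n)
product-applyUpTo-∣ f∣g zero    = ∣-refl
product-applyUpTo-∣ f∣g (suc n) = *-pres-∣ (f∣g 0) (product-applyUpTo-∣ (f∣g ∘ suc) n)

product-applyUpTo-suc : ∀ f n → product (applyUpTo f (suc n)) ≡ product (applyUpTo f n) * f n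
product-applyUpTo-suc f n = begin
  product (applyUpTo f (suc n))           ≡⟨ cong product (applyUpTo-∷ʳ f n) ⟨
  product (applyUpTo f n ∷ʳ f n)          ≡⟨ product-++ (applyUpTo f n) (f n ∷ []) ⟩
  product (applyUpTo f n) * (f n * 1)     ≡⟨ cong (product (applyUpTo f n) *_) (*-identityʳ (f n)) ⟩
  product (applyUpTo f n) * f n           ∎
  where open ≡-Reasoning

factorialSet-suc-∣ : ∀ (b : Sequence ℕ) n → factorialSet b n * b (suc n) ∣ factorialSet b (suc n)
factorialSet-suc-∣ b n = subst (factorialSet b n * b (suc n) ∣_) (sym (product-applyUpTo-suc _ n))
  (*-pres-∣
    (product-applyUpTo-∣ (λ i → ^-monoʳ-∣ (b (suc i)) (/-monoˡ-≤ (suc i) (n≤1+n n))) n)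
    -- The newly added factor has exponent (n+1)/(n+1) = 1, so it is `b (suc n)` itself.
    (∣-reflexive (sym (trans (cong (b (suc n) ^_) (n/n≡1 (suc n))) (^-identityʳ _)))))

-- The last factor alone suffices: (n+1)! divides `b (suc n)`, which divides the term of index n+1.
factorialSet-selfFactorial : ∀ (b : Sequence ℕ) → (∀ n .{{_ : NonZero n}} → n ! ∣ b n) →
                             SelfFactorial (factorialSet b)
factorialSet-selfFactorial b n!∣b zero    = ∣-refl
factorialSet-selfFactorial b n!∣b (suc n) = ∣-trans (n!∣b (suc n))
  (∣-trans (n∣m*n (factorialSet b n)) (factorialSet-suc-∣ b n))

-- The series of reciprocal powers of a factorial set.

module _ (b : Sequence ℕ) (b≢0 : ∀ n .{{_ : NonZero n}} → NonZero (b n))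
         (n!∣b : ∀ n .{{_ : NonZero n}} → n ! ∣ b n) where

  private
    B = factorialSet b

  B∣B-suc : ∀ n → B n ∣ B (suc n)
  B∣B-suc n = ∣-trans (m∣m*n (b (suc n))) (factorialSet-suc-∣ b n)

  c : ℕ → ℕ
  c n = quotient (B∣B-suc n)

  B-suc : ∀ n → B (suc n) ≡ B n * c n
  B-suc n = m∣n⇒n≡m*quotient (B∣B-suc n)

  -- Cancelling `B n` from B n · b (n+1) ≤ B (n+1) = B n · c n leaves b (n+1) ≤ c n, and b (n+1) is
  -- a positive multiple of (n+1)!.
  n<c : ∀ n → n < c n
  n<c n = begin
    suc n      ≤⟨ m≤m*n (suc n) (n !) {{n !≢0}} ⟩
    suc n !    ≤⟨ ∣⇒≤ {{b≢0 (suc n)}} (n!∣b (suc n)) ⟩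
    b (suc n)  ≤⟨ *-cancelˡ-≤ (B n) {{factorialSet≢0 b b≢0 n}} (≤-trans
                    (∣⇒≤ {{factorialSet≢0 b b≢0 (suc n)}} (factorialSet-suc-∣ b n))
                    (≤-reflexive (B-suc n))) ⟩
    c n        ∎
    where open ≤-Reasoning

  reciprocalPowers-irrational : ∀ k → 1 ≤ k →
    ∃[ x ] (HasSum (reciprocalPowers b b≢0 k) x × Irrational x)
  reciprocalPowers-irrational k 1≤k =
    sum , HasSum-partialSum (reciprocalPowers b b≢0 k) s-cauchy , sum-irrational
    where
    -- With `1 ≤ k`, raising the quotients to the power `k` preserves their growth beyond `n`.
    c≤c^k : ∀ n → c n ≤ c n ^ k
    c≤c^k n = subst (_≤ c n ^ k) (^-identityʳ (c n))
      (^-monoʳ-≤ (c n) {{>-nonZero (≤-trans (s≤s z≤n) (n<c n))}} 1≤k)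
    open ReciprocalSeries (λ n → B n ^ k)
      (λ n → m^n≢0 (B n) k {{factorialSet≢0 b b≢0 n}})
      (λ n → c n ^ k)
      (λ n → trans (cong (_^ k) (B-suc n)) (^-distribʳ-* k (B n) (c n)))
      (λ n → ≤-trans (n<c n) (c≤c^k n))

proposition59 : (h : Sequence ℕ)
    (hc : ∀ n .{{_ : NonZero n}} → HighlyComposite (h n)) →
    (∀ n .{{_ : NonZero n}} → n ! ∣ h n) →
    SelfFactorial (factorialSet h) ×
    (∀ k → 1 ≤ k →
    ∃[ x ] (HasSum (reciprocalPowers h (λ n → HighlyComposite.positive (hc n)) k) x × Irrational x))
proposition59 h hc n!∣h =
  factorialSet-selfFactorial h n!∣h ,
  reciprocalPowers-irrational h (λ n → HighlyComposite.positive (hc n)) n!∣h
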